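{- For any integer $g\ge 3$, there exists an oriented graph $D$ with maximum degree $\Delta(D)=3$, ${\rm fas}(D)>a(D)/95$ and directed girth at least $g$. In particular, for every $g\ge 3$, ${\rm fas}(3,g)>\frac{1}{95}$ and ${\rm fasd}(3,g)\le 94$.
   Context: An oriented graph is a digraph without loops, multiple arcs or directed $2$-cycles. Degree = in-degree + out-degree; directed girth = minimum length of a directed cycle ($\infty$ if none). ${\rm fas}(D)$ is the minimum size of a feedback arc set (arc set whose removal makes $D$ acyclic), $a(D)=|A(D)|$, and ${\rm fasd}(D)$ is the maximum number of feedback arc sets into which $A(D)$ can be partitioned ($\infty$ if $D$ acyclic). ${\rm fas}(\Delta,g)$ is the supremum of ${\rm fas}(D)/a(D)$ and ${\rm fasd}(\Delta,g)$ the minimum of ${\rm fasd}(D)$, both over oriented graphs $D$ (with at least one arc) of maximum degree at most $\Delta$ and directed girth at least $g$. -}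

module Defs where

open import Data.Nat using (ℕ; _≤_; _<_; _*_)
open import Data.Fin using (Fin; _≟_)
open import Data.Product using (Σ; _×_; _,_; proj₁; proj₂; ∃-syntax)
open import Data.Sum using (_⊎_)
open import Data.List using (List; []; _∷_; length; filter)
open import Data.List.Membership.Propositional using (_∈_; _∉_)
open import Data.List.Relation.Unary.Unique.Propositional using (Unique)
open import Data.List.Relation.Unary.All using (All)
open import Relation.Nullary using (¬_)
open import Data.Empty using (⊥)
open import Relation.Nullary.Decidable using (_⊎-dec_)
open import Relation.Binary.PropositionalEquality using (_≡_; _≢_)

record Digraph : Set where
  constructor mkDigraph
  field
    n    : ℕ
    arcs : List (Fin n × Fin n)
open Digraph public

Arc : Digraph → Set
Arc D = Fin (n D) × Fin (n D)

IsOriented : Digraph → Set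
IsOriented D =
  Unique (arcs D)
  × (∀ u v → (u , v) ∈ arcs D → u ≢ v)
  × (∀ u v → (u , v) ∈ arcs D → (v , u) ∉ arcs D)

a : Digraph → ℕ
a D = length (arcs D)

degree : (D : Digraph) → Fin (n D) → ℕ
degree D v = length (filter (λ e → (v ≟ proj₁ e) ⊎-dec (v ≟ proj₂ e)) (arcs D))

MaxDegreeEq : Digraph → ℕ → Set
MaxDegreeEq D k = (∀ v → degree D v ≤ k) × (∃[ v ] degree D v ≡ k)

Chain : {V : Set} → (V → V → Set) → V → V → List V → Set
Chain R f x []       = R x f
Chain R f x (y ∷ ys) = R x y × Chain R f y ys

IsDirectedCycle : {V : Set} → (V → V → Set) → List V → Set
IsDirectedCycle R []       = ⊥
IsDirectedCycle R (x ∷ xs) = Unique (x ∷ xs) × Chain R x x xs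

ArcOutside : (D : Digraph) → (Arc D → Set) → Fin (n D) → Fin (n D) → Set
ArcOutside D F u v = ((u , v) ∈ arcs D) × ¬ F (u , v)

ArcOf : (D : Digraph) → Fin (n D) → Fin (n D) → Set
ArcOf D u v = (u , v) ∈ arcs D

DirectedGirth≥ : Digraph → ℕ → Set
DirectedGirth≥ D g = ∀ cs → IsDirectedCycle (ArcOf D) cs → g ≤ length cs

IsFAS : (D : Digraph) → List (Arc D) → Set
IsFAS D F = Unique F × All (_∈ arcs D) F
  × (∀ cs → ¬ IsDirectedCycle (ArcOutside D (_∈ F)) cs)

-- fas(D) > a(D)/95 : every feedback arc set F satisfies a(D) < 95 |F|
FasExceeds : Digraph → ℕ → Set
FasExceeds D k = ∀ F → IsFAS D F → a D < k * length F

PartitionIntoFAS : (D : Digraph) → ℕ → Set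
PartitionIntoFAS D k = Σ (Arc D → Fin k) λ c → (∀ (i : Fin k) cs →
  ¬ IsDirectedCycle (ArcOutside D (λ e → c e ≡ i)) cs)

{-# OPTIONS --safe #-}
module Submission where

-- Let H be a digraph of out-degree 10 on 3q vertices such that any disjoint
-- q-sets A, B are joined by an arc from A to B, and with few (compared to q)
-- directed cycles of length at most g.  Replace every vertex of H by a directed
-- path through its in-ports and then its out-ports, and delete an arc from each
-- short cycle.  The result D has maximum degree 3, girth at least g and at most
-- 90q arcs.  If F were a feedback arc set with 95|F| ≤ a(D), then F and the
-- deleted arcs would touch at most q of the paths.  Ordering the other 2q
-- vertices of H along an acyclic order of D − F, no arc of H leads from the
-- last q of them to the first q, a contradiction.
--
-- Such an H exists: for independent uniform heads, the expected number of pairs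
-- A, B without an arc from A to B is at most 3^(3q) (2/3)^(10q) < 2^(-q), and the
-- expected number of short cycles is bounded in terms of g alone.  A choice of
-- heads that is no worse than average for a weighted sum of both counts is found
-- by the method of conditional expectations.

open import Defs
open import Data.Bool using (if_then_else_)
open import Data.Empty using (⊥; ⊥-elim)
open import Data.Fin as Fin using (Fin; zero; suc; toℕ; _≟_; _↑ˡ_; _↑ʳ_; splitAt; combine; quotient; remainder; finToFun; funToFin)
import Data.Fin.Properties as Fin
open import Data.List using (List; []; _∷_; _++_; length; map; filter; tabulate; allFin; lookup; take; drop; cartesianProduct; cartesianProductWith)
import Data.List.Properties as List
open import Data.List.Membership.Propositional using (_∈_; _∉_)
open import Data.List.Membership.Propositional.Properties
import Data.List.Membership.DecPropositional as DecMembership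
open import Data.List.Relation.Binary.Permutation.Propositional using (_↭_; ↭-refl; ↭-sym; ↭-trans; ↭-prep; ↭⇒↭ₛ)
import Data.List.Relation.Binary.Permutation.Propositional.Properties as Perm
import Data.List.Relation.Binary.Permutation.Setoid.Properties as PermSetoid
open import Data.List.Relation.Unary.All as All using (All; []; _∷_)
import Data.List.Relation.Unary.All.Properties as All
open import Data.List.Relation.Unary.AllPairs as AllPairs using (AllPairs; []; _∷_)
open import Data.List.Relation.Unary.Any using (here; there)
open import Data.List.Relation.Unary.Unique.Propositional using (Unique)
open import Data.List.Relation.Unary.Sorted.TotalOrder.Properties using (Sorted⇒AllPairs)
import Data.List.Relation.Unary.Unique.DecPropositional as DecUnique
import Data.List.Relation.Unary.Unique.Propositional.Properties as Unique
open import Data.Nat renaming (_≟_ to _≟ᴺ_)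
open import Data.Nat.ListAction using (sum; product)
open import Data.Nat.ListAction.Properties using (product-++; product-↭)
open import Data.Nat.Properties hiding (_≟_)
open import Data.Nat.Solver using (module +-*-Solver)
open import Data.Product using (_×_; _,_; proj₁; proj₂; ∃-syntax; ∃₂)
open import Data.Product.Properties using (≡-dec)
open import Data.Sum using (_⊎_; inj₁; inj₂; [_,_]′)
open import Data.Unit using (⊤; tt)
open import Function using (_∘_; id)
open import Relation.Binary using (DecTotalOrder)
import Relation.Binary.Construct.On as On
open import Relation.Binary.PropositionalEquality
open import Relation.Nullary using (¬_; Dec; yes; no)
open import Relation.Nullary.Decidable using (does; ¬?; _×-dec_; _→-dec_; _⊎-dec_)

open +-*-Solver using (solve; _:=_; _:+_; _:*_; con)

-- Finite counting

module _ {A : Set} where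

  ∈⇒↭∷ : ∀ {x : A} {ys} → x ∈ ys → ∃[ zs ] ys ↭ x ∷ zs
  ∈⇒↭∷ x∈ys with as , bs , refl ← ∈-∃++ x∈ys = as ++ bs , Perm.shift _ as bs

  ∈-tail : ∀ {x y : A} {zs} → x ≢ y → y ∈ x ∷ zs → y ∈ zs
  ∈-tail x≢y (here y≡x) = ⊥-elim (x≢y (sym y≡x))
  ∈-tail _ (there y∈) = y∈

  -- Used to split a product over all coordinates into the constrained coordinates and the rest.
  unique-completion : ∀ {xs ys : List A} → Unique xs → (∀ {x} → x ∈ xs → x ∈ ys) →
                      ∃[ zs ] ys ↭ xs ++ zs
  unique-completion {[]} _ _ = _ , ↭-refl
  unique-completion {x ∷ xs} (x≢ ∷ u) sub
    with ys′ , p ← ∈⇒↭∷ (sub (here refl))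
    with zs , r ← unique-completion u (λ y∈ → ∈-tail (All.lookup x≢ y∈) (Perm.∈-resp-↭ p (sub (there y∈))))
    = zs , ↭-trans p (↭-prep x r)

allPairs-++ : {A : Set} {R : A → A → Set} {xs ys : List A} → AllPairs R (xs ++ ys) →
              ∀ {x y} → x ∈ xs → y ∈ ys → R x y
allPairs-++ {xs = x ∷ xs} (r ∷ _) (here refl) y∈ = All.lookup r (∈-++⁺ʳ xs y∈)
allPairs-++ {xs = x ∷ xs} (_ ∷ rs) (there x∈) y∈ = allPairs-++ rs x∈ y∈

module _ {A B : Set} (R : A → B → Set) where

  -- A relation that is injective in its first argument serves in place of an injection, so degrees
  -- and arcs are counted below by giving each arc a distinct tag. The induction deletes the partner
  -- of the head from `ys`.
  matching-length-≤ : (∀ {x x′ y} → R x y → R x′ y → x ≡ x′) → ∀ {xs ys} → Unique xs →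
                      (∀ {x} → x ∈ xs → ∃[ y ] (y ∈ ys × R x y)) → length xs ≤ length ys
  matching-length-≤ inj {[]} _ _ = z≤n
  matching-length-≤ inj {x ∷ xs} {ys} (x≢ ∷ u) match
    with y , y∈ , r ← match (here refl)
    with ys′ , p ← ∈⇒↭∷ y∈
    = subst (suc (length xs) ≤_) (sym (Perm.↭-length p)) (s≤s (matching-length-≤ inj u λ x′∈ →
        let y′ , y′∈ , r′ = match (there x′∈)
        in y′ , ∈-tail (λ { refl → All.lookup x≢ x′∈ (inj r r′) }) (Perm.∈-resp-↭ p y′∈) , r′))

unique-length-≤ : {A : Set} {xs ys : List A} → Unique xs → (∀ {x} → x ∈ xs → x ∈ ys) →
                  length xs ≤ length ys
unique-length-≤ u sub = matching-length-≤ _≡_ (λ p q → trans p (sym q)) u (λ x∈ → _ , sub x∈ , refl)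

length-allFin : ∀ n → length (allFin n) ≡ n
length-allFin n = List.length-tabulate id

filter-split : {A : Set} {P : A → Set} (P? : ∀ x → Dec (P x)) (xs : List A) →
               length (filter (¬? ∘ P?) xs) + length (filter P? xs) ≡ length xs
filter-split P? [] = refl
filter-split P? (x ∷ xs) with P? x
... | yes _ = trans (+-suc _ _) (cong suc (filter-split P? xs))
... | no _ = cong suc (filter-split P? xs)

ind : {P : Set} → Dec P → ℕ
ind d = if does d then 1 else 0

ind-mono : {P Q : Set} (p? : Dec P) (q? : Dec Q) → (P → Q) → ind p? ≤ ind q?
ind-mono (no _) _ _ = z≤n
ind-mono (yes _) (yes _) _ = ≤-refl
ind-mono (yes p) (no ¬q) f = ⊥-elim (¬q (f p))

ind-true : {P : Set} (p? : Dec P) → P → ind p? ≡ 1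
ind-true (yes _) _ = refl
ind-true (no ¬p) p = ⊥-elim (¬p p)

ind-false : {P : Set} (p? : Dec P) → ¬ P → ind p? ≡ 0
ind-false (yes p) ¬p = ⊥-elim (¬p p)
ind-false (no _) _ = refl

sum-ind : ∀ {n} {P : Fin n → Set} (P? : ∀ i → Dec (P i)) →
          sum (tabulate (ind ∘ P?)) ≡ length (filter P? (allFin n))
sum-ind {n} P? = trans (cong sum (sym (List.map-tabulate id (ind ∘ P?)))) (go (allFin n))
  where
  go : ∀ xs → sum (map (ind ∘ P?) xs) ≡ length (filter P? xs)
  go [] = refl
  go (x ∷ xs) with P? x
  ... | yes _ = cong suc (go xs)
  ... | no _ = go xs

-- Rank functions of acyclic relations

module _ {V : Set} {R : V → V → Set} where

  Path : V → List V → Set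
  Path x [] = ⊤
  Path x (y ∷ ys) = R x y × Path y ys

  -- A path that reaches `f` is cut at that visit; with `f` equal to `x`, the part before the cut
  -- closes up into a cycle.
  path⇒chain : ∀ {x f ys} → Path x ys → f ∈ ys → ∃₂ λ as bs → ys ≡ as ++ f ∷ bs × Chain R f x as
  path⇒chain (r , _) (here refl) = [] , _ , refl , r
  path⇒chain (r , p) (there f∈) with as , bs , refl , c ← path⇒chain p f∈ = _ ∷ as , bs , refl , r , c

  unique-prefix : ∀ (as : List V) {x bs} → Unique (as ++ x ∷ bs) → Unique (x ∷ as)
  unique-prefix [] _ = [] ∷ []
  unique-prefix (a ∷ as) (a≢ ∷ u) with x≢ ∷ u′ ← unique-prefix as u
    = (≢-sym (All.lookup a≢ (∈-insert as)) ∷ x≢) ∷ (All.++⁻ˡ as a≢ ∷ u′)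

-- The rank of x counts the k < n for which some walk with k arcs starts at x.
module _ {n : ℕ} {R : Fin n → Fin n → Set} (R? : ∀ x y → Dec (R x y))
         (acyclic : ∀ cs → ¬ IsDirectedCycle R cs) where

  open DecMembership (_≟_ {n}) using (_∈?_)

  -- By induction the vertices after `x` are distinct, so a return to `x` would make the prefix
  -- before it a directed cycle.
  path-unique : ∀ {x} xs → Path {R = R} x xs → Unique (x ∷ xs)
  path-unique [] _ = [] ∷ []
  path-unique {x} (y ∷ ys) (r , p) with path-unique ys p | x ∈? (y ∷ ys)
  ... | u | no x∉ = All.¬Any⇒All¬ _ x∉ ∷ u
  ... | u | yes x∈ with as , bs , eq , c ← path⇒chain {R = R} (r , p) x∈
      = ⊥-elim (acyclic (x ∷ as) (unique-prefix {R = R} as (subst Unique eq u) , c))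

  HasWalk : ℕ → Fin n → Set
  HasWalk zero x = ⊤
  HasWalk (suc k) x = ∃[ y ] (R x y × HasWalk k y)

  hasWalk? : ∀ k x → Dec (HasWalk k x)
  hasWalk? zero x = yes tt
  hasWalk? (suc k) x = Fin.any? (λ y → R? x y ×-dec hasWalk? k y)

  walk⇒path : ∀ k {x} → HasWalk k x → ∃[ xs ] (Path {R = R} x xs × length xs ≡ k)
  walk⇒path zero _ = [] , tt , refl
  walk⇒path (suc k) (y , r , w) with ys , p , refl ← walk⇒path k w = y ∷ ys , (r , p) , refl

  no-long-walk : ∀ x → ¬ HasWalk n x
  no-long-walk x w with xs , p , eq ← walk⇒path n w = 1+n≰n (begin
    suc n                ≡⟨ cong suc eq ⟨
    length (x ∷ xs)      ≤⟨ unique-length-≤ (path-unique xs p) (λ {v} _ → ∈-allFin v) ⟩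
    length (allFin n)    ≡⟨ length-allFin n ⟩
    n                    ∎)
    where open ≤-Reasoning

  walkCount : ℕ → Fin n → ℕ
  walkCount zero x = 0
  walkCount (suc k) x = ind (hasWalk? k x) + walkCount k x

  -- Prepending the arc turns a walk of `j` arcs from `y` into one of `j + 1` arcs from `x`. The
  -- strict gain is the empty walk at `x`.
  walkCount-step : ∀ k {x y} → R x y → walkCount k y < walkCount (suc k) x
  walkCount-step zero r = ≤-refl
  walkCount-step (suc k) {x} {y} r = begin
    suc (ind (hasWalk? k y) + walkCount k y)         ≡⟨ +-suc _ _ ⟨
    ind (hasWalk? k y) + suc (walkCount k y)         ≤⟨ +-mono-≤ (ind-mono (hasWalk? k y) (hasWalk? (suc k) x) (λ w → y , r , w)) (walkCount-step k r) ⟩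
    ind (hasWalk? (suc k) x) + walkCount (suc k) x   ∎
    where open ≤-Reasoning

  acyclic⇒rank : ∃[ ρ ] (∀ {x y} → R x y → ρ y < ρ x)
  -- By pigeonhole no walk has `n` arcs, so the counts up to `suc n` and up to `n` agree at `x` and
  -- `walkCount-step` compares the same rank at both ends.
  acyclic⇒rank = walkCount n , λ {x} {y} r →
    subst (walkCount n y <_) (cong (_+ walkCount n x) (ind-false (hasWalk? n x) (no-long-walk x)))
      (walkCount-step n r)

-- The method of conditional expectations

exists-≤-average : ∀ {k} (g : Fin (suc k) → ℕ) → ∃[ y ] suc k * g y ≤ sum (tabulate g)
exists-≤-average {zero} g = zero , ≤-refl
exists-≤-average {suc k} g with y , le ← exists-≤-average (g ∘ suc) with ≤-total (g zero) (g (suc y))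
... | inj₁ p = zero , +-monoʳ-≤ (g zero) (≤-trans (*-monoʳ-≤ (suc k) p) le)
... | inj₂ p = suc y , +-mono-≤ p le

sum-tabulate-+ : ∀ {n} (g h : Fin n → ℕ) →
                 sum (tabulate (λ i → g i + h i)) ≡ sum (tabulate g) + sum (tabulate h)
sum-tabulate-+ {zero} g h = refl
sum-tabulate-+ {suc n} g h rewrite sum-tabulate-+ (g ∘ suc) (h ∘ suc) =
  solve 4 (λ a b c d → (a :+ b) :+ (c :+ d) := (a :+ c) :+ (b :+ d)) refl (g zero) (h zero) _ _

sum-tabulate-* : ∀ {n} c (g : Fin n → ℕ) p →
                 sum (tabulate (λ i → c * g i * p)) ≡ c * (sum (tabulate g) * p)
sum-tabulate-* {zero} c g p = sym (*-zeroʳ c)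
sum-tabulate-* {suc n} c g p rewrite sum-tabulate-* c (g ∘ suc) p =
  solve 4 (λ c a s p → c :* a :* p :+ c :* (s :* p) := c :* ((a :+ s) :* p)) refl c (g zero) _ p

sum-tabulate-0 : ∀ n → sum (tabulate {n = n} (λ _ → 0)) ≡ 0
sum-tabulate-0 zero = refl
sum-tabulate-0 (suc n) = sum-tabulate-0 n

-- An entry (c , W) stands for c · ∏ᵢ Wᵢ(f i), a product of independent factors
-- when the values f i are chosen at random.
Weights : ℕ → ℕ → Set
Weights M m = List (ℕ × (Fin M → Fin m → ℕ))

value : ∀ {M m} → Weights M m → (Fin M → Fin m) → ℕ
value [] f = 0
value ((c , W) ∷ ws) f = c * product (tabulate (λ i → W i (f i))) + value ws f

-- By distributivity this is the sum of `value ws f` over all `f`, hence `m ^ M` times the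
-- expectation. The product form allows conditioning on one coordinate at a time.
total : ∀ {M m} → Weights M m → ℕ
total [] = 0
total ((c , W) ∷ ws) = c * product (tabulate (λ i → sum (tabulate (W i)))) + total ws

-- Conditioning on the first random value: its factor becomes a constant and is absorbed into the
-- coefficient.
fixFirst : ∀ {M m} → Fin m → Weights (suc M) m → Weights M m
fixFirst y [] = []
fixFirst y ((c , W) ∷ ws) = (c * W zero y , W ∘ suc) ∷ fixFirst y ws

total-fixFirst : ∀ {M m} (ws : Weights (suc M) m) → total ws ≡ sum (tabulate (λ y → total (fixFirst y ws)))
total-fixFirst {m = m} [] = sym (sum-tabulate-0 m)
total-fixFirst ((c , W) ∷ ws) = sym (trans (sum-tabulate-+ _ (λ y → total (fixFirst y ws)))
  (cong₂ _+_ (sum-tabulate-* c (W zero) _) (sym (total-fixFirst ws))))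

consFun : ∀ {M m} → Fin m → (Fin M → Fin m) → Fin (suc M) → Fin m
consFun y f zero = y
consFun y f (suc i) = f i

value-fixFirst : ∀ {M m} (ws : Weights (suc M) m) y f → value ws (consFun y f) ≡ value (fixFirst y ws) f
value-fixFirst [] y f = refl
value-fixFirst ((c , W) ∷ ws) y f = cong₂ _+_ (sym (*-assoc c (W zero y) _)) (value-fixFirst ws y f)

-- The total is the sum of the `m` conditional totals, so some first value has a conditional total
-- no larger than the average; the remaining values are chosen recursively.
derandomise : ∀ {M} m .{{_ : NonZero m}} (ws : Weights M m) → ∃[ f ] m ^ M * value ws f ≤ total ws
derandomise {zero} (suc k) ws = (λ ()) , ≤-trans (≤-reflexive (*-identityˡ _)) (go ws)
  where
  go : ∀ (ws : Weights 0 (suc k)) → value ws (λ ()) ≤ total ws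
  go [] = z≤n
  go ((c , W) ∷ ws) = +-monoʳ-≤ (c * 1) (go ws)
derandomise {suc M} (suc k) ws
  with y , le ← exists-≤-average (λ y → total (fixFirst y ws))
  with f , le′ ← derandomise (suc k) (fixFirst y ws) = consFun y f , (begin
    suc k ^ suc M * value ws (consFun y f)              ≡⟨ cong (suc k ^ suc M *_) (value-fixFirst ws y f) ⟩
    suc k * suc k ^ M * value (fixFirst y ws) f         ≡⟨ *-assoc (suc k) (suc k ^ M) _ ⟩
    suc k * (suc k ^ M * value (fixFirst y ws) f)       ≤⟨ *-monoʳ-≤ (suc k) le′ ⟩
    suc k * total (fixFirst y ws)                       ≤⟨ le ⟩
    sum (tabulate (λ y → total (fixFirst y ws)))        ≡⟨ total-fixFirst ws ⟨
    total ws                                            ∎)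
  where open ≤-Reasoning

value-++ : ∀ {M m} (ws ws′ : Weights M m) f → value (ws ++ ws′) f ≡ value ws f + value ws′ f
value-++ [] ws′ f = refl
value-++ ((c , W) ∷ ws) ws′ f = trans (cong (c * _ +_) (value-++ ws ws′ f)) (sym (+-assoc (c * _) (value ws f) _))

total-++ : ∀ {M m} (ws ws′ : Weights M m) → total (ws ++ ws′) ≡ total ws + total ws′
total-++ [] ws′ = refl
total-++ ((c , W) ∷ ws) ws′ = trans (cong (c * _ +_) (total-++ ws ws′)) (sym (+-assoc (c * _) (total ws) _))

product-map-≤ : {A : Set} (S : A → ℕ) (b : ℕ) (xs : List A) → (∀ {x} → x ∈ xs → S x ≤ b) →
                product (map S xs) ≤ b ^ length xs
product-map-≤ S b [] _ = ≤-refl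
product-map-≤ S b (x ∷ xs) le = *-mono-≤ (le (here refl)) (product-map-≤ S b xs (le ∘ there))

-- In terms of probabilities: if each coordinate in `es` succeeds with probability at most `b / m`,
-- then by independence all do with probability at most the power of that. Denominators are cleared.
product-tabulate-≤ : ∀ {M} (S : Fin M → ℕ) {b m} es → Unique es → (∀ {i} → i ∈ es → S i ≤ b) →
                     (∀ i → S i ≤ m) → product (tabulate S) * m ^ length es ≤ b ^ length es * m ^ M
product-tabulate-≤ {M} S {b} {m} es u Sb Sm with rest , p ← unique-completion u (λ {i} _ → ∈-allFin i) = begin
  product (tabulate S) * m ^ length es
    ≡⟨ cong (λ xs → product xs * m ^ length es) (List.map-tabulate id S) ⟨
  product (map S (allFin M)) * m ^ length es
    ≡⟨ cong (_* m ^ length es) (product-↭ (Perm.map⁺ S p)) ⟩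
  product (map S (es ++ rest)) * m ^ length es
    ≡⟨ cong (λ xs → product xs * m ^ length es) (List.map-++ S es rest) ⟩
  product (map S es ++ map S rest) * m ^ length es
    ≡⟨ cong (_* m ^ length es) (product-++ (map S es) (map S rest)) ⟩
  product (map S es) * product (map S rest) * m ^ length es
    ≤⟨ *-monoˡ-≤ (m ^ length es) (*-mono-≤ (product-map-≤ S b es Sb) (product-map-≤ S m rest (λ _ → Sm _))) ⟩
  b ^ length es * m ^ length rest * m ^ length es
    ≡⟨ *-assoc (b ^ length es) _ _ ⟩
  b ^ length es * (m ^ length rest * m ^ length es)
    ≡⟨ cong (b ^ length es *_) (trans (*-comm (m ^ length rest) _) (sym (^-distribˡ-+-* m (length es) (length rest)))) ⟩
  b ^ length es * m ^ (length es + length rest)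
    ≡⟨ cong (λ k → b ^ length es * m ^ k) (trans (sym (List.length-++ es)) (trans (sym (Perm.↭-length p)) (length-allFin M))) ⟩
  b ^ length es * m ^ M ∎
  where open ≤-Reasoning

product-ones : ∀ {M} (S : Fin M → ℕ) → (∀ i → S i ≡ 1) → product (tabulate S) ≡ 1
product-ones {zero} S _ = refl
product-ones {suc M} S eq rewrite eq zero | product-ones (S ∘ suc) (eq ∘ suc) = refl

-- Counting and expectation of events that are conjunctions of independent conditions

module Events {I : Set} {M m : ℕ} {P : I → Fin M → Fin m → Set} (P? : ∀ x i y → Dec (P x i y)) where

  Occurs : (Fin M → Fin m) → I → Set
  Occurs f x = ∀ i → P x i (f i)

  abstract
    occurs? : ∀ f x → Dec (Occurs f x)
    occurs? f x = Fin.all? (λ i → P? x i (f i))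

  choices : I → Fin M → ℕ
  choices x i = length (filter (P? x i) (allFin m))

  choices-≤ : ∀ x i ys → (∀ {y} → P x i y → y ∈ ys) → choices x i ≤ length ys
  choices-≤ x i ys sub = unique-length-≤ (Unique.filter⁺ (P? x i) (Unique.allFin⁺ m))
    (λ y∈ → sub (proj₂ (∈-filter⁻ (P? x i) {xs = allFin m} y∈)))

  choices-≤-all : ∀ x i → choices x i ≤ m
  choices-≤-all x i = ≤-trans (choices-≤ x i (allFin m) (λ {y} _ → ∈-allFin y)) (≤-reflexive (length-allFin m))

  weigh : ℕ → List I → Weights M m
  weigh c = map (λ x → c , λ i y → ind (P? x i y))

  -- All factors of an occurring event are 1, so it contributes its full coefficient `c`; the other
  -- entries contribute at least 0.
  value-weigh : ∀ c f xs → c * length (filter (occurs? f) xs) ≤ value (weigh c xs) f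
  value-weigh c f [] = ≤-reflexive (*-zeroʳ c)
  value-weigh c f (x ∷ xs) with occurs? f x
  ... | no _ = ≤-trans (value-weigh c f xs) (m≤n+m _ _)
  ... | yes occ rewrite product-ones (λ i → ind (P? x i (f i))) (λ i → ind-true (P? x i (f i)) (occ i))
                      | *-suc c (length (filter (occurs? f) xs)) | *-identityʳ c
      = +-monoʳ-≤ c (value-weigh c f xs)

  -- Linearity of expectation, given a common bound `B / d` on the number of favourable choices of
  -- each event.
  total-weigh : ∀ c xs {d B} → (∀ {x} → x ∈ xs → product (tabulate (choices x)) * d ≤ B) →
                total (weigh c xs) * d ≤ c * (length xs * B)
  total-weigh c [] _ = z≤n
  total-weigh c (x ∷ xs) {d} {B} le = begin
    (c * product (tabulate (λ i → sum (tabulate (λ y → ind (P? x i y))))) + total (weigh c xs)) * d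
      ≡⟨ cong (λ l → (c * product l + total (weigh c xs)) * d) (List.tabulate-cong (λ i → sum-ind (P? x i))) ⟩
    (c * product (tabulate (choices x)) + total (weigh c xs)) * d
      ≡⟨ *-distribʳ-+ d (c * product (tabulate (choices x))) _ ⟩
    c * product (tabulate (choices x)) * d + total (weigh c xs) * d
      ≤⟨ +-mono-≤ (≤-trans (≤-reflexive (*-assoc c _ d)) (*-monoʳ-≤ c (le (here refl)))) (total-weigh c xs (le ∘ there)) ⟩
    c * B + c * (length xs * B)
      ≡⟨ *-distribˡ-+ c B _ ⟨
    c * (B + length xs * B) ∎
    where open ≤-Reasoning

length-cartesianProductWith : {A B C : Set} (f : A → B → C) (xs : List A) (ys : List B) →
                              length (cartesianProductWith f xs ys) ≡ length xs * length ys
length-cartesianProductWith f [] ys = refl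
length-cartesianProductWith f (x ∷ xs) ys = trans (List.length-++ (map (f x) ys))
  (cong₂ _+_ (List.length-map (f x) ys) (length-cartesianProductWith f xs ys))

^-distribʳ-* : ∀ a b n → (a * b) ^ n ≡ a ^ n * b ^ n
^-distribʳ-* a b zero = refl
^-distribʳ-* a b (suc n) = trans (cong (a * b *_) (^-distribʳ-* a b n)) ([m*n]*[o*p]≡[m*o]*[n*p] a b _ _)

-- A pseudorandom digraph of out-degree 10

-- The sum of `10 ^ k` for `k` from 1 to `g`: there are `(10 * m) ^ k` sequences of `k` arcs, and
-- one with distinct arcs is a closed walk with probability at most `1 / m ^ k`.
expectedShort : ℕ → ℕ
expectedShort zero = 0
expectedShort (suc l) = 10 ^ suc l + expectedShort l

ArcWalk : ∀ {M m} → (Fin M → Fin m) → (Fin M → Fin m) → Fin m → List (Fin M) → Fin m → Set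
ArcWalk t f a [] b = a ≡ b
ArcWalk t f a (e ∷ es) b = t e ≡ a × ArcWalk t f (f e) es b

module Construct (q m : ℕ) (m≡3q : m ≡ 3 * q) .{{_ : NonZero q}} where

  M : ℕ
  M = m * 10

  tail : Fin M → Fin m
  tail = quotient {m} 10

  instance
    m≢0 : NonZero m
    m≢0 = subst NonZero (sym m≡3q) (m*n≢0 3 q)

  open DecMembership (_≟_ {m}) using (_∈?_)

  -- A colouring χ encodes the pair A = χ⁻¹(0), B = χ⁻¹(1).
  module Cut where

    -- Stated arc by arc, so that `Occurs f χ`, which says that no arc leads from colour 0 to colour
    -- 1, is a conjunction of independent conditions on the heads.
    Avoids : (Fin m → Fin 3) → Fin M → Fin m → Set
    Avoids χ e y = ¬ (χ (tail e) ≡ zero × χ y ≡ suc zero)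

    avoids? : ∀ χ e y → Dec (Avoids χ e y)
    avoids? χ e y = ¬? ((χ (tail e) ≟ zero) ×-dec (χ y ≟ suc zero))

    open Events avoids? public

    class : (Fin m → Fin 3) → Fin 3 → List (Fin m)
    class χ c = filter (λ v → χ v ≟ c) (allFin m)

    Balanced : (Fin m → Fin 3) → Set
    Balanced χ = q ≤ length (class χ zero) × q ≤ length (class χ (suc zero))

    balanced? : ∀ χ → Dec (Balanced χ)
    balanced? χ = (q ≤? _) ×-dec (q ≤? _)

    colourings : List (Fin m → Fin 3)
    colourings = map finToFun (allFin (3 ^ m))

    cuts : List (Fin m → Fin 3)
    cuts = filter balanced? colourings

    length-cuts : length cuts ≤ 3 ^ m
    length-cuts = ≤-trans (List.length-filter balanced? colourings)
      (≤-reflexive (trans (List.length-map (finToFun {3} {m}) (allFin (3 ^ m))) (length-allFin (3 ^ m))))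

    fibre : List (Fin m) → List (Fin M)
    fibre vs = cartesianProductWith combine vs (allFin 10)

    tail-fibre : ∀ {e} vs → e ∈ fibre vs → tail e ∈ vs
    tail-fibre vs e∈ with v , j , v∈ , _ , refl ← ∈-cartesianProductWith⁻ combine vs (allFin 10) e∈
      = subst (_∈ vs) (sym (cong proj₁ (Fin.remQuot-combine v j))) v∈

    -- Each of the `10 * q` arcs leaving `q` vertices of colour 0 must miss at least `q` of the
    -- `3 * q` possible heads, which has probability at most 2/3.
    choices-cut : ∀ {χ} → Balanced χ → product (tabulate (choices χ)) * 3 ^ (q * 10) ≤ 2 ^ (q * 10) * m ^ M
    choices-cut {χ} (q≤₀ , q≤₁) = *-cancelʳ-≤ _ _ (q ^ (q * 10)) {{m^n≢0 q (q * 10)}} (begin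
      Π * 3 ^ r * q ^ r            ≡⟨ *-assoc Π _ _ ⟩
      Π * (3 ^ r * q ^ r)          ≡⟨ cong (Π *_) (^-distribʳ-* 3 q r) ⟨
      Π * (3 * q) ^ r              ≡⟨ cong (λ k → Π * k ^ r) m≡3q ⟨
      Π * m ^ r                    ≡⟨ cong (λ k → Π * m ^ k) len ⟨
      Π * m ^ length es            ≤⟨ product-tabulate-≤ (choices χ) es unique few (choices-≤-all χ) ⟩
      (2 * q) ^ length es * m ^ M  ≡⟨ cong (λ k → (2 * q) ^ k * m ^ M) len ⟩
      (2 * q) ^ r * m ^ M          ≡⟨ cong (_* m ^ M) (^-distribʳ-* 2 q r) ⟩
      2 ^ r * q ^ r * m ^ M        ≡⟨ *-assoc (2 ^ r) _ _ ⟩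
      2 ^ r * (q ^ r * m ^ M)      ≡⟨ cong (2 ^ r *_) (*-comm (q ^ r) _) ⟩
      2 ^ r * (m ^ M * q ^ r)      ≡⟨ *-assoc (2 ^ r) _ _ ⟨
      2 ^ r * m ^ M * q ^ r        ∎)
      where
      open ≤-Reasoning
      r = q * 10
      Π = product (tabulate (choices χ))
      -- Exactly `q` vertices are kept, so that the number of constrained arcs is exactly `r`.
      A = take q (class χ zero)
      es = fibre A

      len : length es ≡ r
      len = trans (length-cartesianProductWith combine A (allFin 10))
        (cong (_* 10) (trans (List.length-take q (class χ zero)) (m≤n⇒m⊓n≡m q≤₀)))

      unique : Unique es
      unique = Unique.cartesianProductWith⁺ combine (Fin.combine-injective _ _ _ _)
        (Unique.take⁺ q (Unique.filter⁺ (λ v → χ v ≟ zero) (Unique.allFin⁺ m))) (Unique.allFin⁺ 10)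

      tail-class : ∀ {e} → e ∈ es → χ (tail e) ≡ zero
      tail-class e∈ = proj₂ (∈-filter⁻ (λ v → χ v ≟ zero) {xs = allFin m}
        (subst (tail _ ∈_) (List.take++drop≡id q (class χ zero)) (∈-++⁺ˡ (tail-fibre A e∈))))

      others : List (Fin m)
      others = filter (λ v → ¬? (χ v ≟ suc zero)) (allFin m)

      length-others : length others ≤ 2 * q
      length-others = +-cancelʳ-≤ q _ _ (begin
        length others + q                           ≤⟨ +-monoʳ-≤ (length others) q≤₁ ⟩
        length others + length (class χ (suc zero)) ≡⟨ filter-split (λ v → χ v ≟ suc zero) (allFin m) ⟩
        length (allFin m)                           ≡⟨ trans (length-allFin m) m≡3q ⟩
        3 * q                                       ≡⟨ +-comm q (2 * q) ⟩
        2 * q + q                                   ∎)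

      few : ∀ {e} → e ∈ es → choices χ e ≤ 2 * q
      few {e} e∈ = ≤-trans
        (choices-≤ χ e others (λ {y} av → ∈-filter⁺ (λ v → ¬? (χ v ≟ suc zero)) (∈-allFin y) (λ χy → av (tail-class e∈ , χy))))
        length-others

    -- The expected number of balanced colourings without a crossing arc is at most 1/2: a union
    -- bound over at most `3 ^ m` colourings.
    total-cuts : ∀ c → 2 * total (weigh c cuts) ≤ c * m ^ M
    total-cuts c = *-cancelʳ-≤ _ _ (3 ^ (q * 10)) {{m^n≢0 3 (q * 10)}} (begin
      2 * T * 3 ^ (q * 10)
        ≡⟨ *-assoc 2 T _ ⟩
      2 * (T * 3 ^ (q * 10))
        ≤⟨ *-monoʳ-≤ 2 (total-weigh c cuts (λ χ∈ → choices-cut (proj₂ (∈-filter⁻ balanced? {xs = colourings} χ∈)))) ⟩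
      2 * (c * (length cuts * (2 ^ (q * 10) * m ^ M)))
        ≤⟨ *-monoʳ-≤ 2 (*-monoʳ-≤ c (*-monoˡ-≤ _ (≤-trans length-cuts (≤-reflexive (cong (3 ^_) m≡3q))))) ⟩
      2 * (c * (3 ^ (3 * q) * (2 ^ (q * 10) * m ^ M)))
        ≡⟨ solve 4 (λ c x y z → con 2 :* (c :* (x :* (y :* z))) := c :* z :* (con 2 :* (x :* y))) refl c (3 ^ (3 * q)) (2 ^ (q * 10)) (m ^ M) ⟩
      c * m ^ M * (2 * (3 ^ (3 * q) * 2 ^ (q * 10)))
        ≤⟨ *-monoʳ-≤ (c * m ^ M) numeric ⟩
      c * m ^ M * 3 ^ (q * 10) ∎)
      where
      open ≤-Reasoning
      T = total (weigh c cuts)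

      swap-^ : ∀ a → a ^ (q * 10) ≡ (a ^ 10) ^ q
      swap-^ a = trans (cong (a ^_) (*-comm q 10)) (sym (^-*-assoc a 10 q))

      2≤2^q : 2 ≤ 2 ^ q
      2≤2^q = ^-monoʳ-≤ 2 {1} {q} (>-nonZero⁻¹ q)

      -- Once 2 is replaced by `2 ^ q`, everything is a `q`-th power, and `2 * 27 * 1024 = 55296` is
      -- below `3 ^ 10 = 59049`.
      numeric : 2 * (3 ^ (3 * q) * 2 ^ (q * 10)) ≤ 3 ^ (q * 10)
      numeric = begin
        2 * (3 ^ (3 * q) * 2 ^ (q * 10))   ≤⟨ *-monoˡ-≤ (3 ^ (3 * q) * 2 ^ (q * 10)) 2≤2^q ⟩
        2 ^ q * (3 ^ (3 * q) * 2 ^ (q * 10)) ≡⟨ cong₂ (λ x y → 2 ^ q * (x * y)) (sym (^-*-assoc 3 3 q)) (swap-^ 2) ⟩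
        2 ^ q * (27 ^ q * 1024 ^ q)        ≡⟨ cong (2 ^ q *_) (^-distribʳ-* 27 1024 q) ⟨
        2 ^ q * (27 * 1024) ^ q            ≡⟨ ^-distribʳ-* 2 (27 * 1024) q ⟨
        (2 * (27 * 1024)) ^ q              ≤⟨ ^-monoˡ-≤ q (≤ᵇ⇒≤ (2 * (27 * 1024)) (3 ^ 10) tt) ⟩
        (3 ^ 10) ^ q                       ≡⟨ swap-^ 3 ⟨
        3 ^ (q * 10)                       ∎

  -- Short closed walks with distinct arcs

  module Short where

    open DecUnique (_≟_ {M}) using (unique?)

    -- The heads that a closed walk prescribes: each arc must end at the tail of the next one, and
    -- the last arc at `b`.
    demands : Fin M → List (Fin M) → Fin m → List (Fin M × Fin m)
    demands e [] b = (e , b) ∷ []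
    demands e (e′ ∷ es) b = (e , tail e′) ∷ demands e′ es b

    demands-∈ : ∀ {i} e es b → i ∈ e ∷ es → ∃[ y ] (i , y) ∈ demands e es b
    demands-∈ e [] b (here refl) = b , here refl
    demands-∈ e (e′ ∷ es) b (here refl) = tail e′ , here refl
    demands-∈ e (e′ ∷ es) b (there i∈) with y , y∈ ← demands-∈ e′ es b i∈ = y , there y∈

    -- The implication leaves the heads of arcs outside the walk free, which makes the event a
    -- condition on each coordinate separately.
    Obeys : Fin M × List (Fin M) → Fin M → Fin m → Set
    Obeys (e , es) i y = All (λ (j , z) → j ≡ i → y ≡ z) (demands e es (tail e))

    obeys? : ∀ x i y → Dec (Obeys x i y)
    obeys? (e , es) i y = All.all? (λ (j , z) → (j ≟ i) →-dec (y ≟ z)) (demands e es (tail e))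

    open Events obeys? public

    closed⇒occurs : ∀ f e es → ArcWalk tail f (f e) es (tail e) → Occurs f (e , es)
    closed⇒occurs f e es w i = All.map (λ { eq refl → eq }) (met e es w)
      where
      met : ∀ e es {b} → ArcWalk tail f (f e) es b → All (λ (j , z) → f j ≡ z) (demands e es b)
      met e [] eq = eq ∷ []
      met e (e′ ∷ es) (eq , w) = sym eq ∷ met e′ es w

    -- Distinct arcs have independent heads, and each arc of the walk has at most one admissible
    -- head out of `m`.
    choices-closed : ∀ e es → Unique (e ∷ es) →
                     product (tabulate (choices (e , es))) * m ^ length (e ∷ es) ≤ m ^ M
    choices-closed e es u = begin
      product (tabulate (choices (e , es))) * m ^ length (e ∷ es)
        ≤⟨ product-tabulate-≤ (choices (e , es)) (e ∷ es) u single (choices-≤-all (e , es)) ⟩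
      1 ^ length (e ∷ es) * m ^ M
        ≡⟨ trans (cong (_* m ^ M) (^-zeroˡ (length (e ∷ es)))) (*-identityˡ _) ⟩
      m ^ M ∎
      where
      open ≤-Reasoning
      single : ∀ {i} → i ∈ e ∷ es → choices (e , es) i ≤ 1
      single {i} i∈ with z , z∈ ← demands-∈ e es (tail e) i∈
        = choices-≤ (e , es) i (z ∷ []) (λ ob → here (All.lookup ob z∈ refl))

    Simple : Fin M × List (Fin M) → Set
    Simple (e , es) = Unique (e ∷ es)

    simple? : ∀ x → Dec (Simple x)
    simple? (e , es) = unique? (e ∷ es)

    -- Sequences of `suc l` arcs are enumerated by numbers below `M ^ suc l`, which makes their
    -- count immediate.
    decode : ∀ l → Fin (M ^ suc l) → Fin M × List (Fin M)
    decode l i = finToFun {M} {suc l} i zero , tabulate (finToFun {M} {suc l} i ∘ suc)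

    sequences closedWalks shortWalks : ℕ → List (Fin M × List (Fin M))
    sequences l = map (decode l) (allFin (M ^ suc l))
    closedWalks l = filter simple? (sequences l)
    shortWalks zero = []
    shortWalks (suc l) = closedWalks l ++ shortWalks l

    ∈-sequences : ∀ e es → (e , es) ∈ sequences (length es)
    ∈-sequences e es = subst (_∈ sequences (length es))
      (cong₂ _,_ (decoded zero) (trans (List.tabulate-cong (decoded ∘ suc)) (List.tabulate-lookup es)))
      (∈-map⁺ (decode (length es)) (∈-allFin (funToFin (lookup (e ∷ es)))))
      where
      decoded : ∀ i → finToFun (funToFin (lookup (e ∷ es))) i ≡ lookup (e ∷ es) i
      decoded = Fin.finToFun-funToFin (lookup (e ∷ es))

    ∈-shortWalks : ∀ {g} e es → Unique (e ∷ es) → length es < g → (e , es) ∈ shortWalks g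
    ∈-shortWalks {suc g} e es u l<g with length es ≟ᴺ g
    ... | yes refl = ∈-++⁺ˡ (∈-filter⁺ simple? (∈-sequences e es) u)
    ... | no l≢g = ∈-++⁺ʳ (closedWalks g) (∈-shortWalks e es u (≤∧≢⇒< (s≤s⁻¹ l<g) l≢g))

    total-closedWalks : ∀ l → total (weigh 1 (closedWalks l)) ≤ 10 ^ suc l * m ^ M
    total-closedWalks l = *-cancelʳ-≤ _ _ (m ^ suc l) {{m^n≢0 m (suc l)}} (begin
      total (weigh 1 (closedWalks l)) * m ^ suc l
        ≤⟨ total-weigh 1 (closedWalks l) each ⟩
      1 * (length (closedWalks l) * m ^ M)
        ≡⟨ *-identityˡ _ ⟩
      length (closedWalks l) * m ^ M
        ≤⟨ *-monoˡ-≤ (m ^ M) (List.length-filter simple? (sequences l)) ⟩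
      length (sequences l) * m ^ M
        ≡⟨ cong (_* m ^ M) (trans (List.length-map (decode l) (allFin (M ^ suc l))) (length-allFin (M ^ suc l))) ⟩
      M ^ suc l * m ^ M
        ≡⟨ cong (_* m ^ M) (^-distribʳ-* m 10 (suc l)) ⟩
      m ^ suc l * 10 ^ suc l * m ^ M
        ≡⟨ solve 3 (λ a b c → a :* b :* c := b :* c :* a) refl (m ^ suc l) (10 ^ suc l) (m ^ M) ⟩
      10 ^ suc l * m ^ M * m ^ suc l ∎)
      where
      open ≤-Reasoning
      each : ∀ {x} → x ∈ closedWalks l → product (tabulate (choices x)) * m ^ suc l ≤ m ^ M
      each x∈ with x∈seq , u ← ∈-filter⁻ simple? {xs = sequences l} x∈
              with i , _ , refl ← ∈-map⁻ (decode l) x∈seq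
        = subst (λ k → product (tabulate (choices (decode l i))) * m ^ suc k ≤ m ^ M)
            (List.length-tabulate (finToFun {M} {suc l} i ∘ suc))
            (choices-closed (proj₁ (decode l i)) (proj₂ (decode l i)) u)

    total-shortWalks : ∀ g → total (weigh 1 (shortWalks g)) ≤ expectedShort g * m ^ M
    total-shortWalks zero = z≤n
    total-shortWalks (suc g) = begin
      total (weigh 1 (closedWalks g ++ shortWalks g))
        ≡⟨ cong total (List.map-++ _ (closedWalks g) (shortWalks g)) ⟩
      total (weigh 1 (closedWalks g) ++ weigh 1 (shortWalks g))
        ≡⟨ total-++ (weigh 1 (closedWalks g)) _ ⟩
      total (weigh 1 (closedWalks g)) + total (weigh 1 (shortWalks g))
        ≤⟨ +-mono-≤ (total-closedWalks g) (total-shortWalks g) ⟩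
      10 ^ suc g * m ^ M + expectedShort g * m ^ M
        ≡⟨ *-distribʳ-+ (m ^ M) (10 ^ suc g) _ ⟨
      expectedShort (suc g) * m ^ M ∎
      where open ≤-Reasoning

  -- Choosing the pseudorandom digraph

  record Pseudorandom (g : ℕ) : Set where
    field
      head : Fin M → Fin m
      removed : List (Fin M)
      length-removed : length removed ≤ 1 + 2 * expectedShort g
      -- A rotation of a closed walk is again a closed walk, so every arc of a short one is removed.
      -- The bound on `removed` allows for this, as `shortWalks` lists all rotations.
      short-removed : ∀ e es → Unique (e ∷ es) → length es < g →
                      ArcWalk tail head (head e) es (tail e) → e ∈ removed
      crossing : ∀ A B → Unique A → Unique B → (∀ {v} → v ∈ A → v ∉ B) → q ≤ length A → q ≤ length B →
                 ¬ (∀ e → tail e ∈ A → head e ∉ B)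

  -- The cost 2 (K + 1) of a cut exceeds the average total cost, which is at most 2 K + 1.
  pseudorandom : ∀ g → Pseudorandom g
  pseudorandom g with derandomise m (Cut.weigh (2 * suc (expectedShort g)) Cut.cuts ++ Short.weigh 1 (Short.shortWalks g))
  ... | f , average = record
    { head = f
    ; removed = map proj₁ occurring
    ; length-removed = begin
        length (map proj₁ occurring)  ≡⟨ List.length-map proj₁ occurring ⟩
        length occurring              ≡⟨ *-identityˡ _ ⟨
        1 * length occurring          ≤⟨ Short.value-weigh 1 f (Short.shortWalks g) ⟩
        valueShort                    ≤⟨ m≤n+m valueShort valueCut ⟩
        valueCut + valueShort         ≤⟨ value-small ⟩
        1 + 2 * K                     ∎
    ; short-removed = λ e es u l<g w → ∈-map⁺ proj₁
        (∈-filter⁺ (Short.occurs? f) (Short.∈-shortWalks e es u l<g) (Short.closed⇒occurs f e es w))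
    ; crossing = crossing
    }
    where
    open ≤-Reasoning
    K = expectedShort g
    cutWeights = Cut.weigh (2 * suc K) Cut.cuts
    shortWeights = Short.weigh 1 (Short.shortWalks g)
    valueCut = value cutWeights f
    valueShort = value shortWeights f
    occurring = filter (Short.occurs? f) (Short.shortWalks g)

    value-small : valueCut + valueShort ≤ 1 + 2 * K
    value-small = *-cancelˡ-≤ (m ^ M) {{m^n≢0 m M}} (begin
      m ^ M * (valueCut + valueShort)          ≡⟨ cong (m ^ M *_) (value-++ cutWeights shortWeights f) ⟨
      m ^ M * value (cutWeights ++ shortWeights) f ≤⟨ average ⟩
      total (cutWeights ++ shortWeights)       ≡⟨ total-++ cutWeights shortWeights ⟩
      total cutWeights + total shortWeights    ≤⟨ +-mono-≤ cut-total (Short.total-shortWalks g) ⟩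
      suc K * m ^ M + K * m ^ M                ≡⟨ solve 2 (λ k x → (con 1 :+ k) :* x :+ k :* x := x :* (con 1 :+ con 2 :* k)) refl K (m ^ M) ⟩
      m ^ M * (1 + 2 * K)                      ∎)
      where
      cut-total : total cutWeights ≤ suc K * m ^ M
      cut-total = *-cancelˡ-≤ 2 (≤-trans (Cut.total-cuts (2 * suc K)) (≤-reflexive (*-assoc 2 (suc K) (m ^ M))))

    no-cut : ∀ {χ} → χ ∈ Cut.cuts → ¬ Cut.Occurs f χ
    no-cut {χ} χ∈ occ = <⇒≱ {1 + 2 * K} {2 * suc K} (≤-reflexive (sym (*-suc 2 K))) (begin
      2 * suc K                                                ≡⟨ *-identityʳ _ ⟨
      2 * suc K * 1                                            ≤⟨ *-monoʳ-≤ (2 * suc K) nonempty ⟩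
      2 * suc K * length (filter (Cut.occurs? f) Cut.cuts)     ≤⟨ Cut.value-weigh (2 * suc K) f Cut.cuts ⟩
      valueCut                                                 ≤⟨ m≤m+n valueCut valueShort ⟩
      valueCut + valueShort                                    ≤⟨ value-small ⟩
      1 + 2 * K                                                ∎)
      where
      nonempty : 1 ≤ length (filter (Cut.occurs? f) Cut.cuts)
      nonempty = unique-length-≤ {xs = χ ∷ []} ([] ∷ [])
        (λ { (here refl) → ∈-filter⁺ (Cut.occurs? f) χ∈ occ })

    crossing : ∀ A B → Unique A → Unique B → (∀ {v} → v ∈ A → v ∉ B) → q ≤ length A → q ≤ length B →
               ¬ (∀ e → tail e ∈ A → f e ∉ B)
    crossing A B uA uB disjoint qA qB none = no-cut χ∈ (λ e (p , r) → none e (zero⇒∈A p) (one⇒∈B r))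
      where
      colour : Fin m → Fin 3
      colour v with v ∈? A | v ∈? B
      ... | yes _ | _ = zero
      ... | no _ | yes _ = suc zero
      ... | no _ | no _ = suc (suc zero)

      -- Only colourings decoded from a number are listed in `colourings`, so `colour` is encoded
      -- and decoded; the result agrees with it pointwise.
      χ : Fin m → Fin 3
      χ = finToFun (funToFin colour)

      χ≗ : ∀ v → χ v ≡ colour v
      χ≗ = Fin.finToFun-funToFin colour

      zero⇒∈A : ∀ {v} → χ v ≡ zero → v ∈ A
      zero⇒∈A {v} eq with trans (sym (χ≗ v)) eq
      ... | eq′ with v ∈? A | v ∈? B
      zero⇒∈A _ | _ | yes v∈ | _ = v∈
      zero⇒∈A _ | () | no _ | yes _
      zero⇒∈A _ | () | no _ | no _

      one⇒∈B : ∀ {v} → χ v ≡ suc zero → v ∈ B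
      one⇒∈B {v} eq with trans (sym (χ≗ v)) eq
      ... | eq′ with v ∈? A | v ∈? B
      one⇒∈B _ | () | yes _ | _
      one⇒∈B _ | _ | no _ | yes v∈ = v∈
      one⇒∈B _ | () | no _ | no _

      ∈A⇒zero : ∀ {v} → v ∈ A → χ v ≡ zero
      ∈A⇒zero {v} v∈ = trans (χ≗ v) eq
        where
        eq : colour v ≡ zero
        eq with v ∈? A | v ∈? B
        ... | yes _ | _ = refl
        ... | no v∉ | _ = ⊥-elim (v∉ v∈)

      ∈B⇒one : ∀ {v} → v ∈ B → χ v ≡ suc zero
      ∈B⇒one {v} v∈ = trans (χ≗ v) eq
        where
        eq : colour v ≡ suc zero
        eq with v ∈? A | v ∈? B
        ... | yes v∈A | _ = ⊥-elim (disjoint v∈A v∈)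
        ... | no _ | yes _ = refl
        ... | no _ | no v∉ = ⊥-elim (v∉ v∈)

      class-large : ∀ {c} X → Unique X → (∀ {v} → v ∈ X → χ v ≡ c) → q ≤ length X → q ≤ length (Cut.class χ c)
      class-large {c} X u eq le = ≤-trans le
        (unique-length-≤ u (λ v∈ → ∈-filter⁺ (λ v → χ v ≟ c) (∈-allFin _) (eq v∈)))

      χ∈ : χ ∈ Cut.cuts
      χ∈ = ∈-filter⁺ Cut.balanced? (∈-map⁺ finToFun (∈-allFin (funToFin colour)))
        (class-large A uA ∈A⇒zero qA , class-large B uB ∈B⇒one qB)

  -- The subcubic oriented graph

  module Graph {g : ℕ} (3≤g : 3 ≤ g) (H : Pseudorandom g) (q-large : 19 * (1 + 2 * expectedShort g) ≤ q) where

    open Pseudorandom H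
    open DecMembership (_≟_ {M}) using () renaming (_∈?_ to _∈ᴹ?_)

    N : ℕ
    N = M + M

    -- In-ports are numbered below out-ports, so the order of the indices is the order along the
    -- paths.
    inPort outPort : Fin M → Fin N
    inPort e = e ↑ˡ M
    outPort e = M ↑ʳ e

    label : Fin N → Fin m
    label x = [ head , tail ]′ (splitAt M x)

    label-in : ∀ e → label (inPort e) ≡ head e
    label-in e = cong [ head , tail ]′ (Fin.splitAt-↑ˡ M e M)

    label-out : ∀ e → label (outPort e) ≡ tail e
    label-out e = cong [ head , tail ]′ (Fin.splitAt-↑ʳ M M e)

    in<out : ∀ e e′ → toℕ (inPort e) < toℕ (outPort e′)
    in<out e e′ = begin-strict
      toℕ (inPort e)    ≡⟨ Fin.toℕ-↑ˡ e M ⟩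
      toℕ e             <⟨ Fin.toℕ<n e ⟩
      M                 ≤⟨ m≤m+n M (toℕ e′) ⟩
      M + toℕ e′        ≡⟨ Fin.toℕ-↑ʳ M e′ ⟨
      toℕ (outPort e′)  ∎
      where open ≤-Reasoning

    -- All ports with the same label form a directed path, in-ports first.
    Next : Fin N → Fin N → Set
    Next x y = toℕ x < toℕ y × label x ≡ label y ×
               (∀ z → toℕ x < toℕ z → toℕ z < toℕ y → label z ≢ label x)

    Jump : Fin N → Fin N → Set
    Jump x y = ∃[ e ] (x ≡ outPort e × y ≡ inPort e × e ∉ removed)

    Link : Fin N × Fin N → Set
    Link (x , y) = Next x y ⊎ Jump x y

    link? : ∀ a → Dec (Link a)
    link? (x , y) =
      ((toℕ x <? toℕ y) ×-dec (label x ≟ label y) ×-dec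
        Fin.all? (λ z → (toℕ x <? toℕ z) →-dec ((toℕ z <? toℕ y) →-dec ¬? (label z ≟ label x))))
      ⊎-dec Fin.any? (λ e → (x ≟ outPort e) ×-dec (y ≟ inPort e) ×-dec ¬? (e ∈ᴹ? removed))

    next-functional : ∀ {x y y′} → Next x y → Next x y′ → y ≡ y′
    next-functional {x} {y} {y′} (x<y , eq , gap) (x<y′ , eq′ , gap′) = Fin.toℕ-injective (≤-antisym
      (≮⇒≥ λ y′<y → gap y′ x<y′ y′<y (sym eq′)) (≮⇒≥ λ y<y′ → gap′ y x<y y<y′ (sym eq)))

    next-injective : ∀ {x x′ y} → Next x y → Next x′ y → x ≡ x′
    next-injective {x} {x′} (x<y , eq , gap) (x′<y , eq′ , gap′) = Fin.toℕ-injective (≤-antisym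
      (≮⇒≥ λ x′<x → gap′ x x′<x x<y (trans eq (sym eq′))) (≮⇒≥ λ x<x′ → gap x′ x<x′ x′<y (trans eq′ (sym eq))))

    D : Digraph
    D = mkDigraph N (filter link? (cartesianProduct (allFin N) (allFin N)))

    arc⁺ : ∀ {x y} → Link (x , y) → (x , y) ∈ arcs D
    arc⁺ l = ∈-filter⁺ link? (∈-cartesianProduct⁺ (∈-allFin _) (∈-allFin _)) l

    arc⁻ : ∀ {x y} → (x , y) ∈ arcs D → Link (x , y)
    arc⁻ a∈ = proj₂ (∈-filter⁻ link? {xs = cartesianProduct (allFin N) (allFin N)} a∈)

    unique-arcs : Unique (arcs D)
    unique-arcs = Unique.filter⁺ link? (Unique.cartesianProduct⁺ (Unique.allFin⁺ N) (Unique.allFin⁺ N))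

    -- The shadow in `H` of a path in `D` from `x` to `z` that leaves the ports `xs`: `es` lists the
    -- arcs used by its jumps. Recording that their out-ports lie in `xs` keeps these arcs distinct
    -- when the path is extended.
    Trace : Fin N → Fin N → List (Fin N) → Set
    Trace x z xs = ∃[ es ] (ArcWalk tail head (label x) es (label z) × All (λ e → outPort e ∈ xs) es ×
      Unique es × All (_∉ removed) es × length es ≤ length xs × (es ≡ [] → toℕ x + length xs ≤ toℕ z))

    -- The last component forces a closed trace to use at least one jump.
    trace-step : ∀ {x y z xs} → Link (x , y) → x ∉ xs → Trace y z xs → Trace x z (x ∷ xs)
    trace-step {xs = xs} (inj₁ (x<y , eq , _)) x∉ (es , w , vis , u , kept , len , asc) =
      es , subst (λ a → ArcWalk tail head a es _) (sym eq) w , All.map there vis , u , kept , m≤n⇒m≤1+n len ,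
      λ empty → ≤-trans (≤-trans (≤-reflexive (+-suc _ _)) (+-monoˡ-≤ (length xs) x<y)) (asc empty)
    trace-step (inj₂ (e , refl , refl , e∉)) x∉ (es , w , vis , u , kept , len , _) =
      e ∷ es , (sym (label-out e) , subst (λ a → ArcWalk tail head a es _) (label-in e) w) ,
      here refl ∷ All.map there vis ,
      All.map (λ {o∈ refl → x∉ o∈}) vis ∷ u , e∉ ∷ kept , s≤s len , λ ()

    trace : ∀ {x z} xs → Unique (x ∷ xs) → Chain (ArcOf D) z x xs → Trace x z (x ∷ xs)
    trace {x} {z} [] _ l = trace-step (arc⁻ l) (λ ()) ([] , refl , [] , [] , [] , z≤n , λ _ → ≤-reflexive (+-identityʳ _))
    trace (y ∷ ys) u@(_ ∷ u′) (l , c) = trace-step (arc⁻ l) (Unique.Unique[x∷xs]⇒x∉xs u) (trace ys u′ c)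

    -- A directed cycle shorter than `g` would trace a nonempty closed walk of distinct kept arcs
    -- with fewer than `g` arcs, but the first arc of such a walk is removed.
    girth : DirectedGirth≥ D g
    girth (x ∷ xs) (u , c) = ≮⇒≥ λ short → impossible short (trace xs u c)
      where
      impossible : suc (length xs) < g → ¬ Trace x x (x ∷ xs)
      impossible short ([] , _ , _ , _ , _ , _ , asc) = m+1+n≰m (toℕ x) (asc refl)
      impossible short (e ∷ es , (eq , w) , _ , ue , e∉ ∷ _ , len , _) =
        e∉ (short-removed e es ue (<-≤-trans len (<⇒≤ short))
          (subst (ArcWalk tail head (head e) es) (sym eq) w))

    oriented : IsOriented D
    -- A pair of opposite arcs would be a directed cycle of length 2, below the girth.
    oriented = unique-arcs , (λ u v a∈ u≡v → loopless (arc⁻ a∈) u≡v) , λ u v a∈ b∈ →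
      <⇒≱ {2} {g} 3≤g (girth (u ∷ v ∷ [])
        (((λ u≡v → loopless (arc⁻ a∈) u≡v) ∷ []) ∷ [] ∷ [] , a∈ , b∈))
      where
      loopless : ∀ {u v} → Link (u , v) → u ≢ v
      loopless (inj₁ (u<v , _)) refl = <-irrefl refl u<v
      loopless (inj₂ (e , p , r , _)) refl = <⇒≢ (in<out e e) (cong toℕ (trans (sym r) p))

    -- Maximum degree and number of arcs

    removed-small : 19 * length removed ≤ q
    removed-small = ≤-trans (*-monoʳ-≤ 19 length-removed) q-large

    -- A port has at most one path arc out, one path arc in and one jump, since it is the in-port or
    -- the out-port of a single arc of `H`. These are the three roles.
    degree≤3 : ∀ v → degree D v ≤ 3
    degree≤3 v = matching-length-≤ Role role-injective {ys = allFin 3}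
      (Unique.filter⁺ incident? unique-arcs) (λ a∈ → role (∈-filter⁻ incident? {xs = arcs D} a∈))
      where
      incident? : ∀ e → Dec (v ≡ proj₁ e ⊎ v ≡ proj₂ e)
      incident? e = (v ≟ proj₁ e) ⊎-dec (v ≟ proj₂ e)

      Role : Fin N × Fin N → Fin 3 → Set
      Role (x , y) zero = v ≡ x × Next x y
      Role (x , y) (suc zero) = v ≡ y × Next x y
      Role (x , y) (suc (suc zero)) = (v ≡ x ⊎ v ≡ y) × Jump x y

      role-injective : ∀ {a b r} → Role a r → Role b r → a ≡ b
      role-injective {r = zero} (refl , n) (refl , n′) = cong (v ,_) (next-functional n n′)
      role-injective {r = suc zero} (refl , n) (refl , n′) = cong (_, v) (next-injective n n′)
      role-injective {r = suc (suc zero)} (i , e , refl , refl , _) (i′ , e′ , refl , refl , _) = same i i′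
        where
        same : v ≡ outPort e ⊎ v ≡ inPort e → v ≡ outPort e′ ⊎ v ≡ inPort e′ →
               (outPort e , inPort e) ≡ (outPort e′ , inPort e′)
        same (inj₁ p) (inj₁ p′) = cong (λ e → outPort e , inPort e) (Fin.↑ʳ-injective M e e′ (trans (sym p) p′))
        same (inj₁ p) (inj₂ p′) = ⊥-elim (<⇒≢ (in<out e′ e) (cong toℕ (trans (sym p′) p)))
        same (inj₂ p) (inj₁ p′) = ⊥-elim (<⇒≢ (in<out e e′) (cong toℕ (trans (sym p) p′)))
        same (inj₂ p) (inj₂ p′) = cong (λ e → outPort e , inPort e) (Fin.↑ˡ-injective M e e′ (trans (sym p) p′))

      role : ∀ {a} → a ∈ arcs D × (v ≡ proj₁ a ⊎ v ≡ proj₂ a) → ∃[ r ] (r ∈ allFin 3 × Role a r)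
      role (a∈ , i) with arc⁻ a∈ | i
      ... | inj₁ n | inj₁ p = zero , ∈-allFin _ , p , n
      ... | inj₁ n | inj₂ p = suc zero , ∈-allFin _ , p , n
      ... | inj₂ j | _ = suc (suc zero) , ∈-allFin _ , i , j

    tail-combine : ∀ (u : Fin m) (j : Fin 10) → tail (combine u j) ≡ u
    tail-combine u j = cong proj₁ (Fin.remQuot-combine u j)

    toℕ-out : ∀ (u : Fin m) (j : Fin 10) → toℕ (outPort (combine u j)) ≡ M + (10 * toℕ u + toℕ j)
    toℕ-out u j = trans (Fin.toℕ-↑ʳ M (combine u j)) (cong (M +_) (Fin.toℕ-combine u j))

    label-out-combine : ∀ (u : Fin m) (j : Fin 10) → label (outPort (combine u j)) ≡ u
    label-out-combine u j = trans (label-out _) (tail-combine u j)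

    -- The ten out-ports of `u` have consecutive indices, so no port lies between neighbours.
    next-out : ∀ (u : Fin m) (j j′ : Fin 10) → toℕ j′ ≡ suc (toℕ j) → Next (outPort (combine u j)) (outPort (combine u j′))
    next-out u j j′ eq = ≤-reflexive (sym step) , trans (label-out-combine u j) (sym (label-out-combine u j′)) ,
      λ z x<z z<y _ → <⇒≱ z<y (≤-trans (≤-reflexive step) x<z)
      where
      step : toℕ (outPort (combine u j′)) ≡ suc (toℕ (outPort (combine u j)))
      step = begin
        toℕ (outPort (combine u j′))       ≡⟨ toℕ-out u j′ ⟩
        M + (10 * toℕ u + toℕ j′)          ≡⟨ cong (λ k → M + (10 * toℕ u + k)) eq ⟩
        M + (10 * toℕ u + suc (toℕ j))     ≡⟨ trans (cong (M +_) (+-suc (10 * toℕ u) (toℕ j))) (+-suc M _) ⟩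
        suc (M + (10 * toℕ u + toℕ j))     ≡⟨ cong suc (toℕ-out u j) ⟨
        suc (toℕ (outPort (combine u j)))  ∎
        where open ≡-Reasoning

    -- A vertex of `H` that keeps all ten of its jumps, needed to exhibit a port of degree exactly
    -- 3.
    untouched : ∃[ u ] u ∉ map tail removed
    untouched = Fin.¬∀⟶∃¬ m (_∈ map tail removed) (_∈? map tail removed) λ all → <-irrefl refl (begin-strict
      m                          ≡⟨ length-allFin m ⟨
      length (allFin m)          ≤⟨ unique-length-≤ (Unique.allFin⁺ m) (λ {v} _ → all v) ⟩
      length (map tail removed)  ≡⟨ List.length-map tail removed ⟩
      length removed             ≤⟨ m≤n*m (length removed) 19 ⟩
      19 * length removed        ≤⟨ removed-small ⟩
      q                          <⟨ m<m+n q (≤-trans (>-nonZero⁻¹ q) (m≤m+n q _)) ⟩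
      3 * q                      ≡⟨ m≡3q ⟨
      m                          ∎)
      where open ≤-Reasoning

    maxDegree : MaxDegreeEq D 3
    maxDegree = degree≤3 , v , ≤-antisym (degree≤3 v)
      (unique-length-≤ {xs = star} distinct (λ a∈ → All.lookup star-incident a∈))
      where
      u = proj₁ untouched
      port : Fin 10 → Fin N
      port j = outPort (combine u j)
      -- The second out-port has a path arc from the first, a path arc to the third, and its own
      -- jump.
      v = port (suc zero)
      star = (port zero , v) ∷ (v , port (suc (suc zero))) ∷ (v , inPort (combine u (suc zero))) ∷ []

      n₀ : Next (port zero) v
      n₀ = next-out u zero (suc zero) refl
      n₁ : Next v (port (suc (suc zero)))
      n₁ = next-out u (suc zero) (suc (suc zero)) refl

      distinct : Unique star
      distinct = ((λ eq → <⇒≢ (proj₁ n₀) (cong (toℕ ∘ proj₁) eq)) ∷ (λ eq → <⇒≢ (proj₁ n₀) (cong (toℕ ∘ proj₁) eq)) ∷ []) ∷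
                 ((λ eq → <⇒≢ (in<out _ _) (sym (cong (toℕ ∘ proj₂) eq))) ∷ []) ∷ [] ∷ []

      kept : combine u (suc zero) ∉ removed
      kept e∈ = proj₂ untouched (subst (_∈ map tail removed) (tail-combine u (suc zero)) (∈-map⁺ tail e∈))

      incident : ∀ {a} → Link a → v ≡ proj₁ a ⊎ v ≡ proj₂ a →
                 a ∈ filter (λ e → (v ≟ proj₁ e) ⊎-dec (v ≟ proj₂ e)) (arcs D)
      incident l i = ∈-filter⁺ (λ e → (v ≟ proj₁ e) ⊎-dec (v ≟ proj₂ e)) (arc⁺ l) i

      star-incident : All (_∈ filter (λ e → (v ≟ proj₁ e) ⊎-dec (v ≟ proj₂ e)) (arcs D)) star
      star-incident = incident (inj₁ n₀) (inj₂ refl) ∷ incident (inj₁ n₁) (inj₁ refl) ∷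
                      incident (inj₂ (_ , refl , refl , kept)) (inj₁ refl) ∷ []

    -- Each of the `2 * M` ports starts at most one path arc and each of the `M` arcs of `H` gives
    -- at most one jump, where `M` is `30 * q`.
    few-arcs : a D ≤ 90 * q
    few-arcs = begin
      a D                                          ≤⟨ matching-length-≤ Code code-injective unique-arcs code ⟩
      length codes                                 ≡⟨ List.length-++ (map inj₁ (allFin N)) ⟩
      length (map {B = Fin N ⊎ Fin M} inj₁ (allFin N)) + length (map {B = Fin N ⊎ Fin M} inj₂ (allFin M))
        ≡⟨ cong₂ _+_ (trans (List.length-map inj₁ (allFin N)) (length-allFin N))
                     (trans (List.length-map inj₂ (allFin M)) (length-allFin M)) ⟩
      M + M + M                                    ≡⟨ cong (λ k → k * 10 + k * 10 + k * 10) m≡3q ⟩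
      3 * q * 10 + 3 * q * 10 + 3 * q * 10         ≡⟨ solve 1 (λ q → (con 3 :* q :* con 10 :+ con 3 :* q :* con 10) :+ con 3 :* q :* con 10 := con 90 :* q) refl q ⟩
      90 * q                                       ∎
      where
      open ≤-Reasoning
      codes : List (Fin N ⊎ Fin M)
      codes = map inj₁ (allFin N) ++ map inj₂ (allFin M)

      Code : Fin N × Fin N → Fin N ⊎ Fin M → Set
      Code (x , y) (inj₁ z) = x ≡ z × Next x y
      Code (x , y) (inj₂ e) = x ≡ outPort e × y ≡ inPort e

      code-injective : ∀ {a b c} → Code a c → Code b c → a ≡ b
      code-injective {c = inj₁ z} (refl , n) (refl , n′) = cong (z ,_) (next-functional n n′)
      code-injective {c = inj₂ e} (refl , refl) (refl , refl) = refl

      code : ∀ {a} → a ∈ arcs D → ∃[ c ] (c ∈ codes × Code a c)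
      code a∈ with arc⁻ a∈
      ... | inj₁ n = inj₁ _ , ∈-++⁺ˡ (∈-map⁺ inj₁ (∈-allFin _)) , refl , n
      ... | inj₂ (e , p , r , _) = inj₂ e , ∈-++⁺ʳ (map inj₁ (allFin N)) (∈-map⁺ inj₂ (∈-allFin e)) , p , r

    -- Induction on `k`, which bounds the difference of the indices. A port of the same label
    -- strictly between `x` and `y` splits the problem in two; without one, `Next x y` holds.
    rank-along-path : ∀ {v} (ρ : Fin N → ℕ) → (∀ {x y} → Next x y → label x ≡ v → ρ y < ρ x) →
                      ∀ k {x y} → toℕ y ≤ k + toℕ x → toℕ x < toℕ y → label x ≡ v → label y ≡ v → ρ y < ρ x
    rank-along-path ρ drop-next zero y≤ x<y _ _ = ⊥-elim (<⇒≱ x<y y≤)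
    rank-along-path ρ drop-next (suc k) {x} {y} y≤ x<y ℓx ℓy
      with Fin.any? (λ z → (toℕ x <? toℕ z) ×-dec (toℕ z <? toℕ y) ×-dec (label z ≟ label x))
    ... | yes (z , x<z , z<y , ℓz) = <-trans
          (rank-along-path ρ drop-next k (≤-trans y≤ (≤-trans (≤-reflexive (sym (+-suc k (toℕ x)))) (+-monoʳ-≤ k x<z))) z<y (trans ℓz ℓx) ℓy)
          (rank-along-path ρ drop-next k (s≤s⁻¹ (≤-trans z<y y≤)) x<z ℓx (trans ℓz ℓx))
    ... | no none = drop-next (x<y , trans ℓx (sym ℓy) , λ z x<z z<y ℓz → none (z , x<z , z<y , ℓz)) ℓx

    -- Contradiction from a small feedback arc set

    module Feedback (F : List (Arc D)) (fas : IsFAS D F) (small : 95 * length F ≤ a D) where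

      open DecMembership (≡-dec (_≟_ {N}) (_≟_ {N})) using () renaming (_∈?_ to _∈ᴬ?_)

      ranking : ∃[ ρ ] (∀ {x y} → ArcOutside D (_∈ F) x y → ρ y < ρ x)
      ranking = acyclic⇒rank (λ x y → ((x , y) ∈ᴬ? arcs D) ×-dec ¬? ((x , y) ∈ᴬ? F)) (proj₂ (proj₂ fas))

      ρ : Fin N → ℕ
      ρ = proj₁ ranking

      -- An arc of `F` is charged to the label of its tail. This suffices for path arcs, which stay
      -- within one label, and for jumps, which start at an out-port labelled by the tail in `H`.
      bad : List (Fin m)
      bad = map (label ∘ proj₁) F ++ map tail removed

      length-bad : length bad ≤ q
      -- Dividing `95 * length F ≤ 90 * q` by 5 gives 18/19 of `q` for `F`, and `removed` takes at
      -- most the remaining 1/19.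
      length-bad = *-cancelˡ-≤ 19 (begin
        19 * length bad                                                 ≡⟨ cong (19 *_) (List.length-++ (map (label ∘ proj₁) F)) ⟩
        19 * (length (map (label ∘ proj₁) F) + length (map tail removed)) ≡⟨ cong (19 *_) (cong₂ _+_ (List.length-map (label ∘ proj₁) F) (List.length-map tail removed)) ⟩
        19 * (length F + length removed)                                ≡⟨ *-distribˡ-+ 19 (length F) _ ⟩
        19 * length F + 19 * length removed                             ≤⟨ +-mono-≤ F-small removed-small ⟩
        18 * q + q                                                      ≡⟨ +-comm (18 * q) q ⟩
        19 * q                                                          ∎)
        where
        open ≤-Reasoning
        F-small : 19 * length F ≤ 18 * q
        F-small = *-cancelˡ-≤ 5 (begin
          5 * (19 * length F)  ≡⟨ *-assoc 5 19 (length F) ⟨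
          95 * length F        ≤⟨ small ⟩
          a D                  ≤⟨ few-arcs ⟩
          90 * q               ≡⟨ *-assoc 5 18 q ⟩
          5 * (18 * q)         ∎)

      good : List (Fin m)
      good = filter (λ v → ¬? (v ∈? bad)) (allFin m)

      length-good : q + q ≤ length good
      length-good = +-cancelʳ-≤ q _ _ (begin
        q + q + q                                          ≡⟨ solve 1 (λ q → q :+ q :+ q := con 3 :* q) refl q ⟩
        3 * q                                              ≡⟨ m≡3q ⟨
        m                                                  ≡⟨ length-allFin m ⟨
        length (allFin m)                                  ≡⟨ filter-split (_∈? bad) (allFin m) ⟨
        length good + length (filter (_∈? bad) (allFin m)) ≤⟨ +-monoʳ-≤ (length good) bad-≤ ⟩
        length good + q                                    ∎)
        where
        open ≤-Reasoning
        bad-≤ : length (filter (_∈? bad) (allFin m)) ≤ q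
        bad-≤ = ≤-trans
          (unique-length-≤ (Unique.filter⁺ (_∈? bad) (Unique.allFin⁺ m))
            (λ v∈ → proj₂ (∈-filter⁻ (_∈? bad) {xs = allFin m} v∈)))
          length-bad

      -- The first out-port represents its vertex because it separates the path: all in-ports come
      -- before it and all other out-ports after it.
      first : Fin m → Fin N
      first v = outPort (combine v zero)

      τ : Fin m → ℕ
      τ v = ρ (first v)

      drop-next : ∀ {v} → v ∉ bad → ∀ {x y} → Next x y → label x ≡ v → ρ y < ρ x
      drop-next v∉ n refl = proj₂ ranking (arc⁺ (inj₁ n) , λ a∈ → v∉ (∈-++⁺ˡ (∈-map⁺ (label ∘ proj₁) a∈)))

      along : ∀ {v x y} → v ∉ bad → toℕ x < toℕ y → label x ≡ v → label y ≡ v → ρ y < ρ x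
      along {x = x} {y} v∉ = rank-along-path ρ (drop-next v∉) (toℕ y) (m≤m+n (toℕ y) (toℕ x))

      first-≤ : ∀ e → toℕ (first (tail e)) ≤ toℕ (outPort e)
      first-≤ e = begin
        toℕ (first (tail e))                            ≡⟨ toℕ-out (tail e) zero ⟩
        M + (10 * toℕ (tail e) + 0)                     ≤⟨ +-monoʳ-≤ M (+-monoʳ-≤ (10 * toℕ (tail e)) z≤n) ⟩
        M + (10 * toℕ (tail e) + toℕ (remainder {m} 10 e)) ≡⟨ toℕ-out (tail e) (remainder {m} 10 e) ⟨
        toℕ (outPort (combine (tail e) (remainder {m} 10 e))) ≡⟨ cong (toℕ ∘ outPort) (Fin.combine-remQuot {m} 10 e) ⟩
        toℕ (outPort e)                                 ∎
        where open ≤-Reasoning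

      -- In `D` without `F` one can go from the first out-port of `tail e` to `outPort e`, jump to
      -- `inPort e`, and follow the path to the first out-port of `head e`; `ρ` falls along the way.
      τ-decreases : ∀ e → tail e ∉ bad → head e ∉ bad → τ (head e) < τ (tail e)
      τ-decreases e t∉ h∉ = begin-strict
        τ (head e)       <⟨ along h∉ (in<out e _) (label-in e) (label-out-combine (head e) zero) ⟩
        ρ (inPort e)     <⟨ proj₂ ranking (arc⁺ (inj₂ (e , refl , refl , kept)) , λ a∈ → t∉ (subst (_∈ bad) (label-out e) (∈-++⁺ˡ (∈-map⁺ (label ∘ proj₁) a∈)))) ⟩
        -- The inequality is weak because `e` may itself own the first out-port of its tail.
        ρ (outPort e)    ≤⟨ toFirst (m≤n⇒m<n∨m≡n (first-≤ e)) ⟩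
        τ (tail e)       ∎
        where
        open ≤-Reasoning
        kept : e ∉ removed
        kept e∈ = t∉ (∈-++⁺ʳ (map (label ∘ proj₁) F) (∈-map⁺ tail e∈))

        toFirst : toℕ (first (tail e)) < toℕ (outPort e) ⊎ toℕ (first (tail e)) ≡ toℕ (outPort e) → ρ (outPort e) ≤ τ (tail e)
        toFirst (inj₁ lt) = <⇒≤ (along t∉ lt (label-out-combine (tail e) zero) (label-out e))
        toFirst (inj₂ eq) = ≤-reflexive (cong ρ (sym (Fin.toℕ-injective eq)))

      order : DecTotalOrder _ _ _
      order = On.decTotalOrder ≤-decTotalOrder τ

      open import Data.List.Sort order using (sort; sort-↭; sort-↗)

      sorted : List (Fin m)
      sorted = sort good

      early late : List (Fin m)
      early = take q sorted
      late = drop q sorted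

      split : early ++ late ≡ sorted
      split = List.take++drop≡id q sorted

      length-sorted : q + q ≤ length sorted
      length-sorted = ≤-trans length-good (≤-reflexive (sym (Perm.↭-length (sort-↭ good))))

      unique-sorted : Unique sorted
      unique-sorted = PermSetoid.Unique-resp-↭ (setoid (Fin m)) (↭⇒↭ₛ (↭-sym (sort-↭ good)))
        (Unique.filter⁺ (λ v → ¬? (v ∈? bad)) (Unique.allFin⁺ m))

      ordered : ∀ {u v} → u ∈ early → v ∈ late → τ u ≤ τ v
      ordered = allPairs-++ (subst (AllPairs _) (sym split)
        (Sorted⇒AllPairs (DecTotalOrder.totalOrder order) (sort-↗ good)))

      ∉bad : ∀ {v} → v ∈ early ++ late → v ∉ bad
      ∉bad v∈ = proj₂ (∈-filter⁻ (λ v → ¬? (v ∈? bad)) {xs = allFin m}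
        (Perm.∈-resp-↭ (sort-↭ good) (subst (_ ∈_) split v∈)))

      absurd : ⊥
      absurd = crossing early late (Unique.take⁺ q unique-sorted) (Unique.drop⁺ q unique-sorted)
        (λ v∈ v∈′ → allPairs-++ (subst Unique (sym split) unique-sorted) v∈ v∈′ refl)
        (≤-reflexive (sym (trans (List.length-take q sorted) (m≤n⇒m⊓n≡m (≤-trans (m≤m+n q q) length-sorted)))))
        (≤-trans (m+n≤o⇒m≤o∸n q length-sorted) (≤-reflexive (sym (List.length-drop q sorted))))
        -- As `ρ` falls along arcs, `early` is the final part of the acyclic order: an arc from
        -- `early` to `late` would make `τ` drop where the sorting makes it weakly rise.
        (λ e t∈ h∈ → <⇒≱ (τ-decreases e (∉bad (∈-++⁺ˡ t∈)) (∉bad (∈-++⁺ʳ early h∈))) (ordered t∈ h∈))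

    fasExceeds : FasExceeds D 95
    fasExceeds F fas = ≰⇒> (Feedback.absurd F fas)

-- Partitions into feedback arc sets

sum-fibres : {A : Set} → ∀ {k} (c : A → Fin k) xs →
          sum (tabulate (λ i → length (filter (λ x → c x ≟ i) xs))) ≤ length xs
sum-fibres {k = k} c [] = ≤-reflexive (sum-tabulate-0 k)
sum-fibres {k = k} c (x ∷ xs) = begin
  sum (tabulate (λ i → length (filter (λ x → c x ≟ i) (x ∷ xs))))
    ≡⟨ cong sum (List.tabulate-cong split) ⟩
  sum (tabulate (λ i → ind (c x ≟ i) + length (filter (λ x → c x ≟ i) xs)))
    ≡⟨ sum-tabulate-+ (λ i → ind (c x ≟ i)) _ ⟩
  sum (tabulate (λ i → ind (c x ≟ i))) + sum (tabulate (λ i → length (filter (λ x → c x ≟ i) xs)))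
    ≤⟨ +-mono-≤ one (sum-fibres c xs) ⟩
  1 + length xs ∎
  where
  open ≤-Reasoning
  one : sum (tabulate (λ i → ind (c x ≟ i))) ≤ 1
  one = ≤-trans (≤-reflexive (sum-ind (c x ≟_)))
    (unique-length-≤ {ys = c x ∷ []} (Unique.filter⁺ (c x ≟_) (Unique.allFin⁺ k))
      (λ i∈ → here (sym (proj₂ (∈-filter⁻ (c x ≟_) {xs = allFin k} i∈)))))

  split : ∀ i → length (filter (λ x → c x ≟ i) (x ∷ xs)) ≡ ind (c x ≟ i) + length (filter (λ x → c x ≟ i) xs)
  split i with c x ≟ i
  ... | yes _ = refl
  ... | no _ = refl

-- The smallest of `k` classes has at most `a D / k` arcs; as a feedback arc set it would have more.
fasExceeds⇒¬partition : ∀ D k .{{_ : NonZero k}} → Unique (arcs D) → FasExceeds D k → ¬ PartitionIntoFAS D k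
fasExceeds⇒¬partition D (suc k) u exceeds (c , acyclic) = <⇒≱ (exceeds F fas) (≤-trans (proj₂ smallest) (sum-fibres c (arcs D)))
  where
  smallest = exists-≤-average (λ i → length (filter (λ e → c e ≟ i) (arcs D)))
  i = proj₁ smallest
  F = filter (λ e → c e ≟ i) (arcs D)

  outside : ∀ {u v} → ArcOutside D (_∈ F) u v → ArcOutside D (λ e → c e ≡ i) u v
  outside (a∈ , a∉) = a∈ , λ eq → a∉ (∈-filter⁺ (λ e → c e ≟ i) a∈ eq)

  chain : ∀ {f x} ys → Chain (ArcOutside D (_∈ F)) f x ys → Chain (ArcOutside D (λ e → c e ≡ i)) f x ys
  chain [] r = outside r
  chain (y ∷ ys) (r , rs) = outside r , chain ys rs

  fas : IsFAS D F
  fas = Unique.filter⁺ (λ e → c e ≟ i) u ,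
    All.tabulate (λ a∈ → proj₁ (∈-filter⁻ (λ e → c e ≟ i) a∈)) ,
    λ { (x ∷ xs) (ux , ch) → acyclic i (x ∷ xs) (ux , chain xs ch) }

theorem7 : (g : ℕ) → 3 ≤ g →
    ∃[ D ] (IsOriented D × MaxDegreeEq D 3 × FasExceeds D 95 × DirectedGirth≥ D g
    × ¬ PartitionIntoFAS D 95)
-- Merging classes preserves feedback arc sets, so excluding 95 classes excludes every larger number
-- and leaves at most 94.
theorem7 g 3≤g = D , oriented , maxDegree , fasExceeds , girth , fasExceeds⇒¬partition D 95 unique-arcs fasExceeds
  where
  -- The least `q` for which the bound on `removed` yields `19 * length removed ≤ q`.
  q = 19 * (1 + 2 * expectedShort g)
  open Construct q (3 * q) refl
  open Graph 3≤g (pseudorandom g) ≤-refl
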